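{- Let $G=(V,E)$ be a connected graph. The following statements are equivalent: (i) $G$ is a partial cube. (ii) $G$ is bipartite and, for any $ab\in E$ and any $xy,uv\in F_{ab}$ with $x,u\in W_{ab}$ and $y,v\in W_{ba}$, $$d(x,u)=d(y,v)\quad\text{and}\quad d(x,v)=d(y,u).$$
   Context: Graphs are simple, undirected, nonempty, and not necessarily finite; $d$ denotes the shortest-path distance in $G$. For a set $X$, the hypercube $\mathcal H(X)$ is the graph whose vertices are the finite subsets of $X$, with $P,Q$ adjacent iff $|P\Delta Q|=1$. A graph is a partial cube if it can be isometrically embedded (i.e. by a map preserving shortest-path distances) into $\mathcal H(X)$ for some set $X$. For adjacent $a,b\in V$, $W_{ab}=\{w\in V: d(w,a)<d(w,b)\}$, and $F_{ab}=\{uv\in E: u\in W_{ab},\ v\in W_{ba}\}$. -}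

module Defs where

open import Axiom.ExcludedMiddle using (ExcludedMiddle)
open import Data.Bool.Base using (Bool)
open import Data.List.Base using (List; []; _∷_; length)
import Data.List.Membership.Setoid as Membership
import Data.List.Relation.Binary.Subset.Setoid as Subset
import Data.List.Relation.Unary.Unique.Setoid as Uniqueness
open import Data.List.Relation.Unary.Any using (here)
open import Data.Nat.Base using (ℕ; zero; suc; _≤_; _<_; z≤n; s≤s)
open import Data.Product.Base using (Σ; ∃; _×_; _,_; proj₁; proj₂)
import Data.Product.Base as Prod
open import Data.Sum.Base using (_⊎_)
import Data.Sum.Base as Sum
open import Function.Base using (_∘_)
open import Function.Bundles using (Func; _⇔_; mk⇔; Equivalence)
open import Level using (Level; 0ℓ) renaming (suc to lsuc)
open import Relation.Binary.Bundles using (Setoid)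
open import Relation.Binary.Core using (Rel)
open import Relation.Binary.Definitions using (Irreflexive; Symmetric; _Respects₂_)
open import Relation.Binary.PropositionalEquality.Core using (_≡_; _≢_; refl)
open import Relation.Nullary.Decidable.Core using (yes; no)
open import Relation.Nullary.Negation.Core using (¬_; contradiction)
open import Relation.Unary using (Pred; _∪_; _∖_)

private
  variable
    ℓ : Level

-- Sets are setoids throughout, so that quotients (and finite subsets up to
-- extensional equality) are available as vertex sets.

record Graph (ℓ : Level) : Set (lsuc ℓ) where
  field
    vertices : Setoid ℓ ℓ
  open Setoid vertices public using (_≈_) renaming (Carrier to V)
  field
    E        : Rel V ℓ
    E-resp-≈ : E Respects₂ _≈_
    E-irrefl : Irreflexive _≈_ E
    E-sym    : Symmetric E
    nonempty : V

module _ (G : Graph ℓ) where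
  open Graph G

  data Walk : V → V → ℕ → Set ℓ where
    nil  : ∀ {u v} → u ≈ v → Walk u v 0
    cons : ∀ {u w v n} → E u w → Walk w v n → Walk u v (suc n)

  Connected : Set ℓ
  Connected = ∀ u v → ∃ λ n → Walk u v n

  -- d(u , v) = n.  A walk of minimal length repeats no vertex, so minimising
  -- over walks is the same as minimising over paths.
  Dist : V → V → ℕ → Set ℓ
  Dist u v n = Walk u v n × (∀ m → Walk u v m → n ≤ m)

  IsDistance : (V → V → ℕ) → Set ℓ
  IsDistance d = ∀ u v → Dist u v (d u v)

  record Bipartite : Set ℓ where
    field
      colour      : V → Bool
      colour-cong : ∀ {u v} → u ≈ v → colour u ≡ colour v
      proper      : ∀ {u v} → E u v → colour u ≢ colour v

  module _ (d : V → V → ℕ) where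

    W : V → V → Pred V 0ℓ
    W a b w = d w a < d w b

    -- The unordered edge uv belongs to F_ab, hence the two orientations.
    F : V → V → V → V → Set ℓ
    F a b u v = E u v × ((W a b u × W b a v) ⊎ (W a b v × W b a u))

-- Classically every connected graph has a distance function, so taking one
-- as given does not restrict the class of graphs.
distance-exists : ExcludedMiddle ℓ → (G : Graph ℓ) → Connected G → ∃ (IsDistance G)
distance-exists {ℓ} em G conn = (λ u v → proj₁ (dist u v)) , (λ u v → proj₂ (dist u v))
  where
  least : (P : ℕ → Set ℓ) → ∀ n → P n → ∃ λ k → P k × (∀ m → P m → k ≤ m)
  least P zero    p = zero , p , λ _ _ → z≤n
  least P (suc n) p with em {P zero}
  ... | yes p₀ = zero , p₀ , λ _ _ → z≤n
  ... | no ¬p₀ with least (P ∘ suc) n p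
  ...   | k , pk , min = suc k , pk , λ where
          zero    p₀ → contradiction p₀ ¬p₀
          (suc m) pm → s≤s (min m pm)

  dist : ∀ u v → ∃ (Dist G u v)
  dist u v = least (Walk G u v) (proj₁ (conn u v)) (proj₂ (conn u v))

module _ (X : Setoid ℓ ℓ) where
  open Setoid X using (Carrier)
  open Membership X using (_∈_)
  open Subset X using (_⊆_)
  open Uniqueness X using (Unique)

  HasCardinality : Pred Carrier ℓ → ℕ → Set ℓ
  HasCardinality S n =
    Σ (List Carrier) λ xs → Unique xs × length xs ≡ n × (∀ y → y ∈ xs ⇔ S y)

  -- Finite subsets are lists, identified when they have the same elements.
  finiteSubsets : Setoid ℓ ℓ
  finiteSubsets = record
    { Carrier       = List Carrier
    ; _≈_           = λ P Q → P ⊆ Q × Q ⊆ P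
    ; isEquivalence = record
      { refl  = (λ i → i) , (λ i → i)
      ; sym   = Prod.swap
      ; trans = λ (p , p′) (q , q′) → (λ i → q (p i)) , (λ i → p′ (q′ i))
      }
    }

  _Δ_ : List Carrier → List Carrier → Pred Carrier ℓ
  P Δ Q = ((_∈ P) ∖ (_∈ Q)) ∪ ((_∈ Q) ∖ (_∈ P))

  private
    module FS = Setoid finiteSubsets

    Δ-mono : ∀ {P P′ Q Q′} → P FS.≈ P′ → Q FS.≈ Q′ → ∀ {y} → (P Δ Q) y → (P′ Δ Q′) y
    Δ-mono (p , p′) (q , q′) =
      Sum.map (λ (i , j) → p i , λ k → j (q′ k)) (λ (i , j) → q i , λ k → j (p′ k))

    card-resp : ∀ {S T : Pred Carrier ℓ} {n} → (∀ {y} → S y → T y) → (∀ {y} → T y → S y) →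
                HasCardinality S n → HasCardinality T n
    card-resp f g (xs , uniq , len , eq) = xs , uniq , len , λ y →
      mk⇔ (f ∘ Equivalence.to (eq y)) (Equivalence.from (eq y) ∘ g)

    irrefl : Irreflexive FS._≈_ (λ P Q → HasCardinality (P Δ Q) 1)
    irrefl (p , q) (x ∷ [] , _ , refl , eq)
      with Equivalence.to (eq x) (here (Setoid.refl X))
    ... | Sum.inj₁ (i , j) = j (p i)
    ... | Sum.inj₂ (i , j) = j (q i)

  hypercube : Graph ℓ
  hypercube = record
    { vertices = finiteSubsets
    ; E        = λ P Q → HasCardinality (P Δ Q) 1
    ; E-resp-≈ =
        (λ {P} {Q} {Q′} q → card-resp (Δ-mono {P} {P} {Q} {Q′} (FS.refl {P}) q)
                                      (Δ-mono {P} {P} {Q′} {Q} (FS.refl {P}) (Prod.swap q)))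
      , (λ {Q} {P} {P′} p → card-resp (Δ-mono {P} {P′} {Q} {Q} p (FS.refl {Q}))
                                      (Δ-mono {P′} {P} {Q} {Q} (Prod.swap p) (FS.refl {Q})))
    ; E-irrefl = λ {P} {Q} → irrefl {P} {Q}
    ; E-sym    = card-resp Sum.swap Sum.swap
    ; nonempty = []
    }

record IsometricEmbedding (G H : Graph ℓ) : Set ℓ where
  private
    module G = Graph G
    module H = Graph H
  field
    map : Func G.vertices H.vertices
  open Func map public using (to; cong)
  field
    isometric : ∀ u v n → Dist G u v n ⇔ Dist H (to u) (to v) n

PartialCube : Graph ℓ → Set (lsuc ℓ)
PartialCube {ℓ} G = Σ (Setoid ℓ ℓ) λ X → IsometricEmbedding G (hypercube X)

{-# OPTIONS --safe #-}
-- (i) ⇒ (ii): in a hypercube, d(P , Q) is the least length of a list covering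
-- P Δ Q, and along an edge labelled e exactly the element e is switched.
-- Hence W_ab consists of the vertices agreeing with a on the label e of ab,
-- every edge of F_ab carries the label e, and switching e at both ends leaves
-- P Δ Q unchanged.  All conclusions are about natural numbers, hence stable
-- under double negation, which supplies the missing decisions in X.
--
-- (ii) ⇒ (i): by (ii) the relation "uv ∈ F_ab" is an equivalence on edges.  A
-- vertex w is sent to the set of classes of edges on a geodesic from a base
-- vertex to w.  An edge ab is equivalent to an edge of a geodesic exactly
-- when the endpoints of the geodesic lie in different halves W_ab, W_ba, and
-- the edges of a geodesic are pairwise inequivalent.
module Submission where

open import Defs
open import Data.Bool.Base using (Bool; true; not)
open import Data.Bool.Properties using (¬-not; not-¬)
open import Data.List.Base using (List; []; _∷_; length)
import Data.List.Membership.Setoid as Membership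
import Data.List.Membership.Setoid.Properties as Membershipₚ
import Data.List.Relation.Binary.Subset.Setoid as Subset
open import Data.List.Relation.Unary.All using ([]; _∷_)
open import Data.List.Relation.Unary.All.Properties using (¬Any⇒All¬; All¬⇒¬Any)
open import Data.List.Relation.Unary.AllPairs using ([]; _∷_)
open import Data.List.Relation.Unary.Any using (here; there)
open import Data.List.Relation.Unary.Any.Properties using (singleton⁻)
import Data.List.Relation.Unary.Unique.Setoid as Uniqueness
open import Data.Nat.Base using (ℕ; suc; _+_; _≤_; _<_; z≤n; s≤s; s≤s⁻¹)
open import Data.Nat.GeneralisedArithmetic using (fold)
open import Data.Nat.Properties
open import Data.Product.Base using (Σ; ∃; _×_; _,_; proj₁; proj₂; swap)
open import Data.Sum.Base using (_⊎_; inj₁; inj₂; [_,_])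
import Data.Sum.Base as Sum
open import Function.Base using (_∘_; id)
open import Function.Bundles using (_⇔_; mk⇔; Equivalence)
open import Level using (Level)
open import Relation.Binary.Bundles using (Setoid)
open import Relation.Binary.Definitions using (tri<; tri≈; tri>)
open import Relation.Binary.PropositionalEquality
  using (_≡_; _≢_; refl; sym; trans; cong; subst; subst₂)
open import Relation.Nullary.Decidable.Core
  using (yes; no; decidable-stable; ¬¬-excluded-middle)
open import Relation.Nullary.Negation.Core using (¬_; contradiction)

open Equivalence using (to; from)

private
  variable
    ℓ : Level

-- Hypercube distance through lists covering the symmetric difference.

module HypercubeDistance (X : Setoid ℓ ℓ) where
  open Setoid X using (Carrier; _≈_; _≉_)
    renaming (refl to ≈-refl; sym to ≈-sym; trans to ≈-trans)
  open Membership X using (_∈_; _∉_)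
  open Membershipₚ using (∈-resp-≈; ∉-resp-≈)
  open Subset X using (_⊆_)
  open Uniqueness X using (Unique)

  private
    H = hypercube X

  infix 4 _∈_⊝_

  _∈_⊝_ : Carrier → List Carrier → List Carrier → Set ℓ
  y ∈ P ⊝ Q = _Δ_ X P Q y

  ⊝-sym : ∀ {y P Q} → y ∈ P ⊝ Q → y ∈ Q ⊝ P
  ⊝-sym = Sum.swap

  -- A case split on `R` in continuation form: membership over `X` need not be decidable, so the
  -- disjunction of `y ∈ P ⊝ R` and `y ∈ R ⊝ Q` holds only up to double negation.
  ⊝-cotrans : ∀ {y P Q} R → y ∈ P ⊝ Q → ¬ y ∈ P ⊝ R → ¬ ¬ y ∈ R ⊝ Q
  ⊝-cotrans R (inj₁ (y∈P , y∉Q)) ¬PR ¬RQ =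
    ¬PR (inj₁ (y∈P , λ y∈R → ¬RQ (inj₁ (y∈R , y∉Q))))
  ⊝-cotrans R (inj₂ (y∈Q , y∉P)) ¬PR ¬RQ =
    ¬RQ (inj₂ (y∈Q , λ y∈R → ¬PR (inj₂ (y∈R , y∉P))))

  -- Symmetric difference is addition modulo 2, so two switches of `y` cancel.
  ⊝-parity : ∀ {y P Q R} → y ∈ P ⊝ R → y ∈ R ⊝ Q → ¬ y ∈ P ⊝ Q
  ⊝-parity (inj₁ (_ , y∉R)) (inj₁ (y∈R , _)) _ = y∉R y∈R
  ⊝-parity (inj₂ (_ , y∉P)) (inj₁ _) (inj₁ (y∈P , _)) = y∉P y∈P
  ⊝-parity (inj₂ _) (inj₁ (_ , y∉Q)) (inj₂ (y∈Q , _)) = y∉Q y∈Q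
  ⊝-parity (inj₁ _) (inj₂ (y∈Q , _)) (inj₁ (_ , y∉Q)) = y∉Q y∈Q
  ⊝-parity (inj₁ (y∈P , _)) (inj₂ _) (inj₂ (_ , y∉P)) = y∉P y∈P
  ⊝-parity (inj₂ (y∈R , _)) (inj₂ (_ , y∉R)) _ = y∉R y∈R

  ⊝-resp-≈ : ∀ {x y P Q} → x ≈ y → x ∈ P ⊝ Q → y ∈ P ⊝ Q
  ⊝-resp-≈ x≈y =
    Sum.map (λ (i , j) → ∈-resp-≈ X x≈y i , ∉-resp-≈ X x≈y j)
            (λ (i , j) → ∈-resp-≈ X x≈y i , ∉-resp-≈ X x≈y j)

  Label : Carrier → List Carrier → List Carrier → Set ℓ
  Label e P Q = ∀ y → (y ≈ e) ⇔ (y ∈ P ⊝ Q)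

  edge⇒label : ∀ {P Q} → Graph.E H P Q → ∃ λ e → Label e P Q
  edge⇒label (e ∷ [] , _ , refl , eq) = e , λ y →
    mk⇔ (to (eq y) ∘ here) (singleton⁻ ∘ from (eq y))

  label⇒edge : ∀ {P Q e} → Label e P Q → Graph.E H P Q
  label⇒edge {e = e} l = e ∷ [] , [] ∷ [] , refl , λ y →
    mk⇔ (to (l y) ∘ singleton⁻) (here ∘ from (l y))

  label-sym : ∀ {e P Q} → Label e P Q → Label e Q P
  label-sym {e} {P} {Q} l y =
    mk⇔ (⊝-sym {y} {P} {Q} ∘ to (l y)) (from (l y) ∘ ⊝-sym {y} {Q} {P})

  label-resp-≈ : ∀ {e f P Q} → e ≈ f → Label e P Q → Label f P Q
  label-resp-≈ e≈f l y =
    mk⇔ (λ y≈f → to (l y) (≈-trans y≈f (≈-sym e≈f))) (λ y∈ → ≈-trans (from (l y) y∈) e≈f)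

  label-self : ∀ {e P Q} → Label e P Q → e ∈ P ⊝ Q
  label-self l = to (l _) ≈-refl

  -- On the way from `A` through `P` and `Q` to `B` the element `e` must be switched somewhere. The
  -- two outer stretches are excluded, and an edge switches only its label.
  same-label : ∀ {e A B P Q} → Label e A B → Graph.E H P Q →
               ¬ e ∈ A ⊝ P → ¬ e ∈ Q ⊝ B → ¬ ¬ Label e P Q
  same-label {e} {A} {B} {P} {Q} l PQ ¬AP ¬QB k =
    ⊝-cotrans {e} {A} {B} P (label-self {e} {A} {B} l) ¬AP λ e∈PB →
    ⊝-cotrans {e} {B} {P} Q (⊝-sym {e} {P} {B} e∈PB) (¬QB ∘ ⊝-sym {e} {B} {Q}) λ e∈QP →
    let f , l′ = edge⇒label {P} {Q} PQ
        e≈f = from (l′ e) (⊝-sym {e} {Q} {P} e∈QP)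
    in k (label-resp-≈ {f} {e} {P} {Q} (≈-sym e≈f) l′)

  Covers : List Carrier → List Carrier → List Carrier → Set ℓ
  Covers xs P Q = ∀ y → y ∈ P ⊝ Q → ¬ y ∉ xs

  covers-switch : ∀ {e P P′ Q Q′ xs} → Label e P P′ → Label e Q Q′ →
                  Covers xs P Q → Covers xs P′ Q′
  covers-switch {e} {P} {P′} {Q} {Q′} l l′ c y P′Q′ y∉xs =
    ⊝-cotrans {y} {P′} {Q′} P P′Q′ (unless ∘ from (l y) ∘ ⊝-sym {y} {P′} {P}) λ PQ′ →
    ⊝-cotrans {y} {P} {Q′} Q PQ′ (λ PQ → c y PQ y∉xs) (unless ∘ from (l′ y))
    where
    -- If `y ≈ e`, then `P` and `Q` agree on `y` because `y` is outside the cover, and switching `y`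
    -- in both keeps the agreement, against `P′Q′`.
    unless : y ≉ e
    unless y≈e =
      ⊝-cotrans {y} {Q} {Q′} P (to (l′ y) y≈e) (λ QP → c y (⊝-sym {y} {Q} {P} QP) y∉xs) λ PQ′ →
      ⊝-parity {y} {P′} {Q′} {P} (⊝-sym {y} {P} {P′} (to (l y) y≈e)) PQ′ P′Q′

  delete : ∀ {x xs} → x ∈ xs →
           ∃ λ ys → length xs ≡ suc (length ys) × (∀ {y} → y ∈ xs → y ≉ x → y ∈ ys)
  delete {xs = z ∷ zs} (here x≈z) = zs , refl , λ where
    (here y≈z) y≉x → contradiction (≈-trans y≈z (≈-sym x≈z)) y≉x
    (there y∈)  _  → y∈
  delete {xs = z ∷ zs} (there x∈) with delete x∈
  ... | ys , len , keep = z ∷ ys , cong suc len , λ where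
    (here y≈z) _   → here y≈z
    (there y∈) y≉x → there (keep y∈ y≉x)

  -- Passing from `A` to `B` cancels the disagreement with `P` on `e` and creates no other, so one
  -- occurrence of `e` can be deleted from the cover.
  covers-cross : ∀ {e P A B xs} → Label e A B → e ∈ P ⊝ A → Covers xs P A →
                 ¬ ¬ ∃ λ ys → length ys < length xs × Covers ys P B
  covers-cross {e} {P} {A} {B} l e∈PA c k = c e e∈PA λ e∈xs →
    let ys , len , keep = delete e∈xs in
    k (ys , ≤-reflexive (sym len) , λ y y∈PB y∉ys →
      let y≉e = λ y≈e → ⊝-parity {y} {P} {B} {A}
                  (⊝-resp-≈ {e} {y} {P} {A} (≈-sym y≈e) e∈PA) (to (l y) y≈e) y∈PB in
      ⊝-cotrans {y} {P} {B} A y∈PB (λ y∈PA → c y y∈PA λ y∈xs → y∉ys (keep y∈xs y≉e))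
        (y≉e ∘ from (l y)))

  -- The pigeonhole principle: match the head with an entry of `xs`, delete that entry and recurse.
  -- Doubly negated membership suffices because `≤` is decidable.
  unique-covered : ∀ {ys} → Unique ys → ∀ xs → (∀ {y} → y ∈ ys → ¬ y ∉ xs) →
                   length ys ≤ length xs
  unique-covered [] xs c = z≤n
  unique-covered {y ∷ ys} (y≉ys ∷ uniq) xs c =
    decidable-stable (_ ≤? _) λ k → c (here ≈-refl) λ y∈xs →
    let zs , len , keep = delete y∈xs in
    k (subst (suc (length ys) ≤_) (sym len)
        (s≤s (unique-covered uniq zs λ z∈ys z∉zs → c (there z∈ys) λ z∈xs →
          z∉zs (keep z∈xs λ z≈y → All¬⇒¬Any y≉ys (∈-resp-≈ X z≈y z∈ys)))))

  -- The cover lists the labels along the walk; an element outside it is never switched.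
  walk⇒covers : ∀ {P Q n} → Walk H P Q n → ∃ λ xs → length xs ≡ n × Covers xs P Q
  walk⇒covers (nil (P⊆Q , Q⊆P)) = [] , refl , λ where
    y (inj₁ (y∈P , y∉Q)) _ → y∉Q (P⊆Q y∈P)
    y (inj₂ (y∈Q , y∉P)) _ → y∉P (Q⊆P y∈Q)
  walk⇒covers {P} {Q} (cons {w = R} PR p) with edge⇒label {P} {R} PR | walk⇒covers p
  ... | e , l | xs , len , c = e ∷ xs , cong suc len , λ y PQ y∉ →
    ⊝-cotrans {y} {P} {Q} R PQ (y∉ ∘ here ∘ from (l y)) λ RQ → c y RQ (y∉ ∘ there)

  -- Double negation commutes with a finite conjunction, here over the entries of `P`.
  ⊆-stable : ∀ {P Q} → (∀ {y} → y ∈ P → ¬ y ∉ Q) → ¬ ¬ (P ⊆ Q)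
  ⊆-stable {[]}    h k = k λ ()
  ⊆-stable {x ∷ P} h k = h (here ≈-refl) λ x∈Q → ⊆-stable (h ∘ there) λ P⊆Q →
    k λ { (here y≈x) → ∈-resp-≈ X (≈-sym y≈x) x∈Q ; (there y∈P) → P⊆Q y∈P }

  remove : ∀ P x → ¬ ¬ ∃ λ R → R ⊆ P × x ∉ R × (∀ {y} → y ∈ P → y ∈ R ⊎ y ≈ x)
  remove [] x k = k ([] , (λ ()) , (λ ()) , λ ())
  remove (p ∷ P) x k = remove P x λ (R , R⊆P , x∉R , keep) →
    ¬¬-excluded-middle λ where
      (yes p≈x) → k (R , there ∘ R⊆P , x∉R , λ where
        (here y≈p)  → inj₂ (≈-trans y≈p p≈x)
        (there y∈P) → keep y∈P)
      (no p≉x)  → k (p ∷ R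
        , (λ { (here y≈p) → here y≈p ; (there y∈R) → there (R⊆P y∈R) })
        , (λ { (here x≈p) → p≉x (≈-sym x≈p) ; (there x∈R) → x∉R x∈R })
        , λ { (here y≈p) → inj₁ (here y≈p) ; (there y∈P) → Sum.map₁ there (keep y∈P) })

  switch : ∀ P x → ¬ ¬ ∃ (Label x P)
  switch P x k = ¬¬-excluded-middle λ where
    (yes x∈P) → remove P x λ (R , R⊆P , x∉R , keep) → k (R , λ y → mk⇔
      (λ y≈x → inj₁ (∈-resp-≈ X (≈-sym y≈x) x∈P , ∉-resp-≈ X (≈-sym y≈x) x∉R))
      [ (λ (y∈P , y∉R) → [ (λ y∈R → contradiction y∈R y∉R) , id ] (keep y∈P))
      , (λ (y∈R , y∉P) → contradiction (R⊆P y∈R) y∉P) ])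
    (no x∉P) → k (x ∷ P , λ y → mk⇔
      (λ y≈x → inj₂ (here y≈x , ∉-resp-≈ X (≈-sym y≈x) x∉P))
      λ { (inj₁ (y∈P , y∉)) → contradiction (there y∈P) y∉
        ; (inj₂ (here y≈x , _)) → y≈x
        ; (inj₂ (there y∈P , y∉P)) → contradiction y∈P y∉P })

  covers⇒walk : ∀ xs {P Q} → Covers xs P Q → ¬ ¬ ∃ λ m → m ≤ length xs × Walk H P Q m
  covers⇒walk [] c k =
    ⊆-stable (λ {y} y∈P y∉Q → c y (inj₁ (y∈P , y∉Q)) λ ()) λ P⊆Q →
    ⊆-stable (λ {y} y∈Q y∉P → c y (inj₂ (y∈Q , y∉P)) λ ()) λ Q⊆P →
    k (0 , z≤n , nil (P⊆Q , Q⊆P))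
  covers⇒walk (x ∷ xs) {P} {Q} c k = ¬¬-excluded-middle λ where
    (yes x∈PQ) → switch P x λ (R , l) →
      covers⇒walk xs {R} {Q} (λ y y∈RQ y∉xs →
        let y≉x = λ y≈x → ⊝-parity {y} {P} {Q} {R} (to (l y) y≈x) y∈RQ
                            (⊝-resp-≈ {x} {y} {P} {Q} (≈-sym y≈x) x∈PQ)
        in ⊝-cotrans {y} {R} {Q} P y∈RQ (y≉x ∘ from (l y) ∘ ⊝-sym {y} {R} {P})
             λ y∈PQ → c y y∈PQ λ { (here y≈x) → y≉x y≈x ; (there y∈xs) → y∉xs y∈xs })
      λ (m , m≤ , p) → k (suc m , s≤s m≤ , cons (label⇒edge {P} {R} l) p)
    (no x∉PQ) → covers⇒walk xs {P} {Q} (λ y y∈PQ y∉xs → c y y∈PQ λ where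
        (here y≈x)   → x∉PQ (⊝-resp-≈ {y} {x} {P} {Q} y≈x y∈PQ)
        (there y∈xs) → y∉xs y∈xs)
      λ (m , m≤ , p) → k (m , m≤n⇒m≤1+n m≤ , p)

-- Shortest-path metric of a graph.

module Metric (G : Graph ℓ) (d : Graph.V G → Graph.V G → ℕ) (isD : IsDistance G d) where
  open Graph G
  private
    module V = Setoid vertices

  walk-respˡ : ∀ {u v w n} → u ≈ v → Walk G v w n → Walk G u w n
  walk-respˡ u≈v (nil v≈w)  = nil (V.trans u≈v v≈w)
  walk-respˡ u≈v (cons e p) = cons (proj₂ E-resp-≈ (V.sym u≈v) e) p

  infixr 5 _++_

  _++_ : ∀ {u v w m n} → Walk G u v m → Walk G v w n → Walk G u w (m + n)
  nil u≈v  ++ q = walk-respˡ u≈v q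
  cons e p ++ q = cons e (p ++ q)

  reverse : ∀ {u v n} → Walk G u v n → Walk G v u n
  reverse (nil u≈v) = nil (V.sym u≈v)
  reverse {n = suc n} (cons e p) =
    subst (Walk G _ _) (+-comm n 1) (reverse p ++ cons (E-sym e) (nil V.refl))

  geodesic : ∀ u v → Walk G u v (d u v)
  geodesic u v = proj₁ (isD u v)

  d-least : ∀ {u v n} → Walk G u v n → d u v ≤ n
  d-least p = proj₂ (isD _ _) _ p

  d-sym : ∀ u v → d u v ≡ d v u
  d-sym u v = ≤-antisym (d-least (reverse (geodesic v u))) (d-least (reverse (geodesic u v)))

  d-self : ∀ u → d u u ≡ 0
  d-self u = n≤0⇒n≡0 (d-least (nil V.refl))

  d-congˡ : ∀ {u v} w → u ≈ v → d u w ≡ d v w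
  d-congˡ {u} {v} w u≈v = ≤-antisym
    (d-least (walk-respˡ u≈v (geodesic v w)))
    (d-least (walk-respˡ (V.sym u≈v) (geodesic u w)))

  d-stepˡ : ∀ {u v} w → E u v → d u w ≤ suc (d v w)
  d-stepˡ w e = d-least (cons e (geodesic _ w))

  dist-edge : ∀ {u v} → E u v → Dist G u v 1
  dist-edge e = cons e (nil V.refl) , λ where
    0       (nil u≈v) → contradiction e (E-irrefl u≈v)
    (suc m) _         → s≤s z≤n

-- Partial cubes are bipartite and satisfy the distance equalities.

module Necessity (G : Graph ℓ) (d : Graph.V G → Graph.V G → ℕ) (isD : IsDistance G d)
                 (X : Setoid ℓ ℓ) (emb : IsometricEmbedding G (hypercube X)) where
  open Graph G
  open Metric G d isD
  open HypercubeDistance X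
  open IsometricEmbedding emb using (isometric) renaming (to to φ)

  private
    H = hypercube X

  d-covers : ∀ u v → ∃ λ xs → length xs ≡ d u v × Covers xs (φ u) (φ v)
  d-covers u v = walk⇒covers (proj₁ (to (isometric u v (d u v)) (isD u v)))

  d-least-cover : ∀ u v xs → Covers xs (φ u) (φ v) → d u v ≤ length xs
  d-least-cover u v xs c = decidable-stable (_ ≤? _) λ k →
    covers⇒walk xs {φ u} {φ v} c λ (m , m≤ , p) →
    k (≤-trans (proj₂ (to (isometric u v (d u v)) (isD u v)) m p) m≤)

  -- Adjacency is distance one, which the isometry preserves.
  edge-image : ∀ {u v} → E u v → Graph.E H (φ u) (φ v)
  edge-image {u} {v} e with proj₁ (to (isometric u v 1) (dist-edge e))
  ... | cons {w = R} e′ (nil R≈) = proj₁ (Graph.E-resp-≈ H) {φ u} {R} {φ v} R≈ e′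

  d-switch : ∀ {e x y u v} → Label e (φ x) (φ y) → Label e (φ u) (φ v) → d y v ≤ d x u
  d-switch {e} {x} {y} {u} {v} l l′ with d-covers x u
  ... | xs , len , c = subst (d y v ≤_) len
    (d-least-cover y v xs (covers-switch {e} {φ x} {φ y} {φ u} {φ v} l l′ c))

  d-cross : ∀ {e a b w} → Label e (φ a) (φ b) → e ∈ φ w ⊝ φ a → d w b < d w a
  d-cross {e} {a} {b} {w} l e∈ with d-covers w a
  ... | xs , len , c = decidable-stable (_ ≤? _) λ k →
    covers-cross {e} {φ w} {φ a} {φ b} l e∈ c λ (ys , ys< , c′) →
    k (subst (suc (d w b) ≤_) len (≤-trans (s≤s (d-least-cover w b ys c′)) ys<))

  W⇒agree : ∀ {e a b w} → Label e (φ a) (φ b) → W G d a b w → ¬ e ∈ φ w ⊝ φ a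
  W⇒agree l w∈ e∈ = <-asym w∈ (d-cross l e∈)

  -- The image of `w` disagrees on the label of `uv` with one of the two ends, and is therefore
  -- strictly closer to the other.
  d-proper : ∀ {u v} w → E u v → d u w ≢ d v w
  d-proper {u} {v} w uv eq =
    let e , l = edge⇒label {φ u} {φ v} (edge-image uv)
        l′ = label-sym {e} {φ u} {φ v} l
    in ⊝-cotrans {e} {φ u} {φ v} (φ w) (label-self {e} {φ u} {φ v} l)
         (λ e∈uw → <-irrefl (trans (d-sym w v) (trans (sym eq) (d-sym u w)))
                     (d-cross {e} {u} {v} {w} l (⊝-sym {e} {φ u} {φ w} e∈uw)))
         (λ e∈wv → <-irrefl (trans (d-sym w u) (trans eq (d-sym v w)))
                     (d-cross {e} {v} {u} {w} l′ e∈wv))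

  -- The parity of the distance to the base vertex.
  colour : V → Bool
  colour v = fold true not (d v nonempty)

  colour-step : ∀ {u v} → E u v → d u nonempty < d v nonempty → colour v ≡ not (colour u)
  colour-step e lt = cong (fold true not) (≤-antisym (d-stepˡ nonempty (E-sym e)) lt)

  bipartite : Bipartite G
  bipartite = record
    { colour      = colour
    ; colour-cong = λ u≈v → cong (fold true not) (d-congˡ nonempty u≈v)
    ; proper      = proper
    }
    where
    proper : ∀ {u v} → E u v → colour u ≢ colour v
    proper {u} {v} e eq with <-cmp (d u nonempty) (d v nonempty)
    ... | tri< lt _ _ = not-¬ (sym eq) (colour-step e lt)
    ... | tri≈ _ d≡ _ = d-proper nonempty e d≡
    ... | tri> _ _ gt = not-¬ eq (colour-step (E-sym e) gt)

  F-label : ∀ {e a b x y} → Label e (φ a) (φ b) → E x y →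
            W G d a b x → W G d b a y → ¬ ¬ Label e (φ x) (φ y)
  F-label {e} {a} {b} {x} {y} l xy x∈ y∈ =
    same-label {e} {φ a} {φ b} {φ x} {φ y} l (edge-image xy)
      (W⇒agree {e} {a} {b} {x} l x∈ ∘ ⊝-sym {e} {φ a} {φ x})
      (W⇒agree {e} {b} {a} {y} (label-sym {e} {φ a} {φ b} l) y∈)

  parallel : ∀ {a b} → E a b → ∀ {x y u v} → E x y → E u v →
             W G d a b x → W G d a b u → W G d b a y → W G d b a v →
             d x u ≡ d y v × d x v ≡ d y u
  parallel {a} {b} ab {x} {y} {u} {v} xy uv x∈ u∈ y∈ v∈ =
    let e , l = edge⇒label {φ a} {φ b} (edge-image ab) in
    decidable-stable (_ ≟ _) (λ k → F-label {x = x} {y = y} l xy x∈ y∈ λ l₁ →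
      F-label {x = u} {y = v} l uv u∈ v∈ λ l₂ → k (≤-antisym
        (d-switch (label-sym {e} {φ x} {φ y} l₁) (label-sym {e} {φ u} {φ v} l₂))
        (d-switch l₁ l₂)))
    -- The same argument with `uv` traversed backwards, which keeps its label.
    , decidable-stable (_ ≟ _) (λ k → F-label {x = x} {y = y} l xy x∈ y∈ λ l₁ →
      F-label {x = u} {y = v} l uv u∈ v∈ λ l₂ → k (≤-antisym
        (d-switch (label-sym {e} {φ x} {φ y} l₁) l₂)
        (d-switch l₁ (label-sym {e} {φ u} {φ v} l₂))))

-- Halves of a bipartite graph and separation by an edge.

module Sufficiency
  (G : Graph ℓ) (d : Graph.V G → Graph.V G → ℕ) (isD : IsDistance G d)
  (bip : Bipartite G)
  (parallel : ∀ a b → Graph.E G a b → ∀ x y u v →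
     F G d a b x y → F G d a b u v →
     W G d a b x → W G d a b u → W G d b a y → W G d b a v →
     d x u ≡ d y v × d x v ≡ d y u) where
  open Graph G
  open Metric G d isD
  open Bipartite bip
  private
    module V = Setoid vertices

  colour-walk : ∀ {u v n} → Walk G u v n → colour u ≡ fold (colour v) not n
  colour-walk (nil u≈v)  = colour-cong u≈v
  colour-walk (cons e p) = trans (¬-not (proper e)) (cong not (colour-walk p))

  -- The colour of a vertex is determined by the colour of `w` and the parity of its distance to
  -- `w`; equal distances would give the ends of an edge one colour.
  d-proper : ∀ {a b} w → E a b → d w a ≢ d w b
  d-proper {a} {b} w e eq = proper e
    (trans (colour-walk (reverse (geodesic w a)))
      (trans (cong (fold (colour w) not) eq)
        (sym (colour-walk (reverse (geodesic w b))))))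

  half : ∀ {a b} → E a b → ∀ w → W G d a b w ⊎ W G d b a w
  half {a} {b} e w with <-cmp (d w a) (d w b)
  ... | tri< lt _ _ = inj₁ lt
  ... | tri≈ _ eq _ = contradiction eq (d-proper w e)
  ... | tri> _ _ gt = inj₂ gt

  W-left : ∀ {a b} → E a b → W G d a b a
  W-left {a} {b} e = ≤∧≢⇒< (subst (_≤ d a b) (sym (d-self a)) z≤n) (d-proper a e)

  -- The condition in `F` freed from adjacency of `u` and `v`, so that it also applies to the ends
  -- of a walk.
  Separates : V → V → V → V → Set
  Separates a b u v = (W G d a b u × W G d b a v) ⊎ (W G d a b v × W G d b a u)

  separates-sym : ∀ {a b u v} → Separates a b u v → Separates a b v u
  separates-sym = Sum.swap

  separates-flip : ∀ {a b u v} → Separates a b u v → Separates b a u v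
  separates-flip = Sum.swap ∘ Sum.map swap swap

  separates-cotrans : ∀ {a b u v} → E a b → ∀ w → Separates a b u v →
                      Separates a b u w ⊎ Separates a b w v
  separates-cotrans e w (inj₁ (u∈ , v∈)) =
    [ (λ w∈ → inj₂ (inj₁ (w∈ , v∈))) , (λ w∈ → inj₁ (inj₁ (u∈ , w∈))) ] (half e w)
  separates-cotrans e w (inj₂ (v∈ , u∈)) =
    [ (λ w∈ → inj₁ (inj₂ (w∈ , u∈))) , (λ w∈ → inj₂ (inj₂ (v∈ , w∈))) ] (half e w)

  separates-parity : ∀ {a b u v w} → Separates a b u w → Separates a b w v →
                     ¬ Separates a b u v
  separates-parity (inj₁ (_ , w∈)) (inj₁ (w∈′ , _)) _ = <-asym w∈ w∈′
  separates-parity (inj₂ (w∈ , _)) (inj₂ (_ , w∈′)) _ = <-asym w∈ w∈′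
  separates-parity (inj₁ (u∈ , _)) (inj₂ _) (inj₂ (_ , u∈′)) = <-asym u∈ u∈′
  separates-parity (inj₁ _) (inj₂ (v∈ , _)) (inj₁ (_ , v∈′)) = <-asym v∈ v∈′
  separates-parity (inj₂ (_ , u∈)) (inj₁ _) (inj₁ (u∈′ , _)) = <-asym u∈ u∈′
  separates-parity (inj₂ _) (inj₁ (_ , v∈)) (inj₂ (v∈′ , _)) = <-asym v∈ v∈′

  separates-irrefl : ∀ {a b u v} → u ≈ v → ¬ Separates a b u v
  separates-irrefl {a} {b} {u} {v} u≈v =
    [ (λ (u∈ , v∈) → <-asym u∈ (resp v∈))
    , (λ (v∈ , u∈) → <-asym (resp v∈) u∈) ]
    where
    resp : ∀ {a b} → W G d a b v → W G d a b u
    resp {a} {b} = subst₂ _<_ (d-congˡ a (V.sym u≈v)) (d-congˡ b (V.sym u≈v))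

  -- The equivalence relation on edges.

  F-sym⁺ : ∀ {a b x y} → E a b → E x y → W G d a b x → W G d b a y →
           W G d x y a × W G d y x b
  F-sym⁺ {a} {b} {x} {y} ab xy x∈ y∈ =
      subst₂ _<_ (d-sym x a) (trans (d-sym x b) (sym day)) x∈
    , subst₂ _<_ (trans (d-sym x a) dax) (d-sym x b) x∈
    where
    -- The edge `ab` lies in its own `F`, so the hypothesis compares it with `xy`.
    eqs = parallel a b ab a b x y (ab , inj₁ (W-left ab , W-left (E-sym ab)))
            (xy , inj₁ (x∈ , y∈)) (W-left ab) x∈ (W-left (E-sym ab)) y∈
    dax = proj₁ eqs
    day = proj₂ eqs

  F-sym : ∀ {a b x y} → E a b → F G d a b x y → F G d x y a b
  F-sym ab (xy , inj₁ (x∈ , y∈)) = ab , inj₁ (F-sym⁺ ab xy x∈ y∈)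
  F-sym ab (xy , inj₂ (y∈ , x∈)) =
    ab , separates-flip (inj₁ (F-sym⁺ ab (E-sym xy) y∈ x∈))

  -- Whichever half of `uv` contains `x`, the two equalities put `y` in the other one. So `uv`
  -- separates `x` from `y`, and `F-sym⁺` exchanges the roles.
  F-euclid⁺ : ∀ {a b x y u v} → E a b → E x y → E u v →
              W G d a b x → W G d b a y → W G d a b u → W G d b a v → Separates x y u v
  F-euclid⁺ {a} {b} {x} {y} {u} {v} ab xy uv x∈ y∈ u∈ v∈
    with parallel a b ab x y u v (xy , inj₁ (x∈ , y∈)) (uv , inj₁ (u∈ , v∈)) x∈ u∈ y∈ v∈
       | half uv x
  ... | xu≡yv , xv≡yu | inj₁ x∈uv =
    inj₁ (F-sym⁺ uv xy x∈uv (subst₂ _<_ xu≡yv xv≡yu x∈uv))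
  ... | xu≡yv , xv≡yu | inj₂ x∈vu =
    inj₂ (F-sym⁺ (E-sym uv) xy x∈vu (subst₂ _<_ xv≡yu xu≡yv x∈vu))

  F-euclid : ∀ {a b x y u v} → E a b → F G d a b x y → F G d a b u v → F G d x y u v
  F-euclid ab (xy , inj₁ (x∈ , y∈)) (uv , inj₁ (u∈ , v∈)) =
    uv , F-euclid⁺ ab xy uv x∈ y∈ u∈ v∈
  F-euclid ab (xy , inj₁ (x∈ , y∈)) (uv , inj₂ (v∈ , u∈)) =
    uv , separates-sym (F-euclid⁺ ab xy (E-sym uv) x∈ y∈ v∈ u∈)
  F-euclid ab (xy , inj₂ (y∈ , x∈)) (uv , inj₁ (u∈ , v∈)) =
    uv , separates-flip (F-euclid⁺ ab (E-sym xy) uv y∈ x∈ u∈ v∈)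
  F-euclid ab (xy , inj₂ (y∈ , x∈)) (uv , inj₂ (v∈ , u∈)) =
    uv , separates-flip (separates-sym (F-euclid⁺ ab (E-sym xy) (E-sym uv) y∈ x∈ v∈ u∈))

  Edge : Set ℓ
  Edge = Σ V λ a → Σ V λ b → E a b

  -- The classes of the Djoković relation, as a setoid on oriented edges; the two orientations of an
  -- edge are identified.
  edgeClasses : Setoid ℓ ℓ
  edgeClasses = record
    { Carrier       = Edge
    ; _≈_           = λ (a , b , _) (x , y , _) → F G d a b x y
    ; isEquivalence = record
      { refl  = λ {(_ , _ , e)} → e , inj₁ (W-left e , W-left (E-sym e))
      ; sym   = λ {(_ , _ , e)} → F-sym e
      ; trans = λ {(_ , _ , e)} {(_ , _ , e′)} p q → F-euclid e′ (F-sym e p) q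
      }
    }

  private
    H = hypercube edgeClasses
  open Membership edgeClasses using (_∈_; _∉_)
  open Membershipₚ using (∈-resp-≈)
  open Uniqueness edgeClasses using (Unique)
  open HypercubeDistance edgeClasses using (_∈_⊝_; walk⇒covers; unique-covered)

  -- Edge classes along walks and geodesics.

  edges : ∀ {u v n} → Walk G u v n → List Edge
  edges (nil _)                = []
  edges (cons {u} {w} e p) = (u , w , e) ∷ edges p

  length-edges : ∀ {u v n} (p : Walk G u v n) → length (edges p) ≡ n
  length-edges (nil _)    = refl
  length-edges (cons _ p) = cong suc (length-edges p)

  -- A walk between the two halves of `ab` has a step that crosses over, and this step is an edge of
  -- `F` for `ab`.
  separates⇒∈ : ∀ {u v n} (y@(a , b , _) : Edge) (p : Walk G u v n) →
                Separates a b u v → y ∈ edges p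
  separates⇒∈ y (nil u≈v) s = contradiction s (separates-irrefl u≈v)
  separates⇒∈ y@(_ , _ , ab) (cons {w = w} e p) s with separates-cotrans ab w s
  ... | inj₁ s′ = here (e , s′)
  ... | inj₂ s′ = there (separates⇒∈ y p s′)

  Geodesic : ∀ {u v n} → Walk G u v n → Set
  Geodesic {u} {v} {n} p = n ≤ d u v

  tail-geodesic : ∀ {u w v n} (e : E u w) (p : Walk G w v n) →
                  Geodesic (cons e p) → Geodesic p
  tail-geodesic {v = v} e p g = s≤s⁻¹ (≤-trans g (d-stepˡ v e))

  -- If the ends lay in one half, the class would be crossed by the first edge and again in the
  -- tail, which `head∉` excludes. The recursion is mutual; `head∉` calls back on the shorter tail.
  ∈⇒separates : ∀ {u v n} (y@(a , b , _) : Edge) (p : Walk G u v n) → Geodesic p →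
                y ∈ edges p → Separates a b u v
  -- A recurrence of the class of `uw` in the tail would put `v` on the side of `u`, whereas the
  -- first step of a geodesic leads closer to `v`.
  head∉ : ∀ {u w v n} (e : E u w) (p : Walk G w v n) → Geodesic (cons e p) →
          (u , w , e) ∉ edges p

  ∈⇒separates y@(_ , _ , ab) (cons {v = v} e p) g (here (_ , s))
    with separates-cotrans ab v s
  ... | inj₁ s′ = s′
  ... | inj₂ s′ = contradiction
    (∈-resp-≈ edgeClasses {x = y} {y = _ , _ , e} (e , s) (separates⇒∈ y p (separates-sym s′)))
    (head∉ e p g)
  ∈⇒separates y@(_ , _ , ab) (cons {u = u} e p) g (there y∈)
    with ∈⇒separates y p (tail-geodesic e p g) y∈
  ... | s with separates-cotrans ab u s
  ...   | inj₂ s′ = s′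
  ...   | inj₁ s′ = contradiction
    (∈-resp-≈ edgeClasses {x = y} {y = _ , _ , e} (e , separates-sym s′) y∈)
    (head∉ e p g)

  head∉ {u} {w} {v} {n} e p g e∈
    with ∈⇒separates (u , w , e) p (tail-geodesic e p g) e∈
  ... | inj₁ (w∈ , _) = <-asym w∈ (W-left (E-sym e))
  ... | inj₂ (v∈ , _) =
    <-irrefl refl (<-≤-trans (subst₂ _<_ (d-sym v u) (d-sym v w) v∈)
      (≤-trans (d-least p) (≤-trans (n≤1+n _) g)))

  unique-edges : ∀ {u v n} (p : Walk G u v n) → Geodesic p → Unique (edges p)
  unique-edges (nil _)    _ = []
  unique-edges (cons e p) g =
    ¬Any⇒All¬ (edges p) (head∉ e p g) ∷ unique-edges p (tail-geodesic e p g)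

  -- The isometric embedding.

  φ : V → List Edge
  φ w = edges (geodesic nonempty w)

  ∈φ⇒separates : ∀ (y@(a , b , _) : Edge) w → y ∈ φ w → Separates a b nonempty w
  ∈φ⇒separates y w = ∈⇒separates y (geodesic nonempty w) ≤-refl

  separates⇒∈φ : ∀ (y@(a , b , _) : Edge) w → Separates a b nonempty w → y ∈ φ w
  separates⇒∈φ y w = separates⇒∈ y (geodesic nonempty w)

  -- A class in exactly one of the two sets separates the base vertex from exactly one of `u` and
  -- `v`, which therefore lie in different halves.
  Δ⇒separates : ∀ (y@(a , b , _) : Edge) u v → y ∈ φ u ⊝ φ v → Separates a b u v
  Δ⇒separates y@(_ , _ , ab) u v (inj₁ (y∈u , y∉v))
    with separates-cotrans ab v (∈φ⇒separates y u y∈u)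
  ... | inj₁ s = contradiction (separates⇒∈φ y v s) y∉v
  ... | inj₂ s = separates-sym s
  Δ⇒separates y@(_ , _ , ab) u v (inj₂ (y∈v , y∉u))
    with separates-cotrans ab u (∈φ⇒separates y v y∈v)
  ... | inj₁ s = contradiction (separates⇒∈φ y u s) y∉u
  ... | inj₂ s = s

  separates⇒Δ : ∀ (y@(a , b , _) : Edge) u v → Separates a b u v → y ∈ φ u ⊝ φ v
  separates⇒Δ y@(_ , _ , ab) u v s with separates-cotrans ab nonempty s
  ... | inj₁ s′ = inj₁ (separates⇒∈φ y u (separates-sym s′) ,
                        λ y∈v → separates-parity s′ (∈φ⇒separates y v y∈v) s)
  ... | inj₂ s′ = inj₂ (separates⇒∈φ y v s′ ,
                        λ y∈u → separates-parity (separates-sym (∈φ⇒separates y u y∈u)) s′ s)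

  φ-mono : ∀ {u v} → u ≈ v → ∀ {y} → y ∈ φ u → y ∈ φ v
  φ-mono {u} {v} u≈v {y@(_ , _ , ab)} y∈
    with separates-cotrans ab v (∈φ⇒separates y u y∈)
  ... | inj₁ s = separates⇒∈φ y v s
  ... | inj₂ s = contradiction s (separates-irrefl (V.sym u≈v))

  edge-image : ∀ {u v} → E u v → Graph.E H (φ u) (φ v)
  edge-image {u} {v} e = (u , v , e) ∷ [] , [] ∷ [] , refl , λ y → mk⇔
    (separates⇒Δ y u v ∘ proj₂ ∘ singleton⁻)
    (λ y∈ → here (e , Δ⇒separates y u v y∈))

  φ-cong : ∀ {u v} → u ≈ v → Setoid._≈_ (Graph.vertices H) (φ u) (φ v)
  φ-cong u≈v = (λ {y} → φ-mono u≈v {y}) , λ {y} → φ-mono (V.sym u≈v) {y}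

  walk-image : ∀ {u v n} → Walk G u v n → Walk H (φ u) (φ v) n
  walk-image (nil u≈v)  = nil (φ-cong u≈v)
  walk-image (cons e p) = cons (edge-image e) (walk-image p)

  -- The labels of a walk cover the symmetric difference, which contains the `d u v` pairwise
  -- inequivalent edges of a geodesic from `u` to `v`; pigeonhole gives the bound.
  d-least-image : ∀ u v {n} → Walk H (φ u) (φ v) n → d u v ≤ n
  d-least-image u v p with walk⇒covers p
  ... | xs , len , c = subst₂ _≤_ (length-edges q) len
    (unique-covered (unique-edges q ≤-refl) xs λ {y} y∈ →
      c y (separates⇒Δ y u v (∈⇒separates y q ≤-refl y∈)))
    where
    q = geodesic u v

  embedding : IsometricEmbedding G H
  embedding = record
    { map       = record { to = φ ; cong = φ-cong }
    ; isometric = λ u v n → mk⇔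
        (λ (p , least) → walk-image p , λ m q →
          ≤-trans (least _ (geodesic u v)) (d-least-image u v q))
        (λ (p , least) → subst (Dist G u v)
          (≤-antisym (d-least-image u v p) (least _ (walk-image (geodesic u v))))
          (isD u v))
    }

theorem4p2 : ∀ {ℓ : Level} (G : Graph ℓ) → Connected G →
    (d : Graph.V G → Graph.V G → ℕ) → IsDistance G d →
    PartialCube G
    ⇔
    ( Bipartite G
    × (∀ a b → Graph.E G a b → ∀ x y u v →
    F G d a b x y → F G d a b u v →
    W G d a b x → W G d a b u → W G d b a y → W G d b a v →
    d x u ≡ d y v × d x v ≡ d y u))
theorem4p2 G _ d isD = mk⇔
  (λ (X , emb) → let open Necessity G d isD X emb in
    bipartite , λ a b ab x y u v xy uv → parallel ab (proj₁ xy) (proj₁ uv))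
  (λ (bip , parallel) → let open Sufficiency G d isD bip parallel in
    edgeClasses , embedding)
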